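{- Let $G$ be a $2$-connected $[4,2]$-graph of order at least $8$. Then $G$ is not uniquely hamiltonian, i.e., $G$ does not contain exactly one Hamilton cycle.
   Context: All graphs are finite and simple. For a positive integer $s$ and a nonnegative integer $t$, a graph $G$ of order at least $s$ is called an $[s,t]$-graph if every induced subgraph of $G$ on $s$ vertices has at least $t$ edges. A graph is uniquely hamiltonian if it contains exactly one Hamilton cycle. -}

module Defs where

open import Data.Nat using (ℕ; zero; suc; _+_; _∸_; _≤_)
open import Data.Bool using (Bool; true; false)
open import Data.Fin using (Fin; toℕ)
open import Data.Product using (Σ; ∃; ∃-syntax; _×_; _,_)
open import Data.Sum using (_⊎_)
open import Data.Unit using (⊤)
open import Relation.Binary.PropositionalEquality using (_≡_; _≢_)
open import Relation.Nullary using (¬_)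
open import Function.Bundles using (Bijection; _⤖_)

record Graph (n : ℕ) : Set where
  field
    adj    : Fin n → Fin n → Bool
    sym    : ∀ x y → adj x y ≡ adj y x
    irrefl : ∀ x → adj x x ≡ false
open Graph public

b2n : Bool → ℕ
b2n true  = 1
b2n false = 0

edges4 : ∀ {n} → Graph n → Fin n → Fin n → Fin n → Fin n → ℕ
edges4 G a b c d =
  b2n (adj G a b) + b2n (adj G a c) + b2n (adj G a d)
  + b2n (adj G b c) + b2n (adj G b d) + b2n (adj G c d)

Is42Graph : ∀ {n} → Graph n → Set
Is42Graph {n} G =
  4 ≤ n ×
  (∀ a b c d → a ≢ b → a ≢ c → a ≢ d → b ≢ c → b ≢ d → c ≢ d →
    2 ≤ edges4 G a b c d)

data Reach {n} (G : Graph n) (ok : Fin n → Set) : Fin n → Fin n → Set where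
  here : ∀ {u} → ok u → Reach G ok u u
  step : ∀ {u v w} → ok u → adj G u v ≡ true → Reach G ok v w → Reach G ok u w

AllOk : ∀ {n} → Fin n → Set
AllOk _ = ⊤

Connected : ∀ {n} → Graph n → Set
Connected G = ∀ u v → Reach G AllOk u v

TwoConnected : ∀ {n} → Graph n → Set
TwoConnected {n} G =
  3 ≤ n × Connected G ×
  (∀ w u v → u ≢ w → v ≢ w → Reach G (λ x → x ≢ w) u v)

Consec : ∀ {n} → Fin n → Fin n → Set
Consec {n} i j = (toℕ j ≡ suc (toℕ i)) ⊎ (toℕ i ≡ n ∸ 1 × toℕ j ≡ 0)

-- H (an edge set) is a Hamilton cycle of G: there is a cyclic ordering σ of
-- all vertices such that consecutive vertices are adjacent in G, and H is
-- exactly the set of edges between cyclically consecutive vertices.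
-- (Meaningful for n ≥ 3.)
IsHamCycle : ∀ {n} → Graph n → (Fin n → Fin n → Bool) → Set
IsHamCycle {n} G H =
  Σ (Fin n ⤖ Fin n) λ σ →
    let f = Bijection.to σ in
    (∀ i j → Consec i j → adj G (f i) (f j) ≡ true) ×
    (∀ x y → (H x y ≡ true →
                ∃[ i ] ∃[ j ] Consec i j × ((f i ≡ x × f j ≡ y) ⊎ (f i ≡ y × f j ≡ x)))
           × (∃[ i ] ∃[ j ] Consec i j × ((f i ≡ x × f j ≡ y) ⊎ (f i ≡ y × f j ≡ x))
                → H x y ≡ true))

UniquelyHamiltonian : ∀ {n} → Graph n → Set
UniquelyHamiltonian {n} G =
  Σ (Fin n → Fin n → Bool) λ H → IsHamCycle G H ×
    (∀ H' → IsHamCycle G H' → ∀ x y → H' x y ≡ H x y)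

{-# OPTIONS --safe #-}
module Submission where

-- Nine consecutive vertices of a Hamilton cycle of a [4,2]-graph always admit a
-- second Hamilton path with the same two ends, and exchanging the two paths gives
-- a second Hamilton cycle.  On eight vertices this can fail for the path, but a
-- spanning 8-cycle of a [4,2]-graph is never its only Hamilton cycle.  Both finite
-- facts are established by decision trees on the adjacencies inside the window.

open import Defs
open import Data.Bool using (Bool; true; false; T; if_then_else_)
import Data.Bool.Properties as Bool
open import Data.Fin using (Fin; toℕ; _↑ˡ_; _↑ʳ_; splitAt; _<?_)
open import Data.Fin.Patterns
open import Data.Fin.Properties using (_≟_; all?; any?; <⇒≢; <-trans; toℕ<n; toℕ-↑ˡ; toℕ-↑ʳ; ↑ˡ-injective; splitAt-↑ˡ; splitAt⁻¹-↑ˡ; splitAt⁻¹-↑ʳ; +↔⊎)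
open import Data.Maybe using (Maybe; just; nothing)
open import Data.Maybe.Properties using (≡-dec; just-injective)
open import Data.Nat as ℕ using (ℕ; zero; suc; _+_; _∸_; _≤_; _≤?_; z≤n; s≤s)
open import Data.Nat.Properties as ℕ using (m≤n⇒∃[o]m+o≡n)
open import Data.Product using (∃; ∃₂; _×_; _,_; proj₁)
open import Data.Sum using (_⊎_; inj₁; inj₂)
open import Data.Sum.Function.Propositional using (_⊎-⤖_)
open import Data.Vec using (Vec; []; _∷_; lookup)
open import Function using (_∘_; _$_; Injective; case_of_)
open import Function.Bundles using (Bijection; _⤖_; mk⤖)
open import Function.Construct.Composition using (_⤖-∘_)
open import Function.Construct.Identity using (⤖-id)
open import Function.Construct.Symmetry using (↔-sym)
open import Function.Properties.Inverse using (↔⇒⤖)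
open import Relation.Binary.PropositionalEquality using (_≡_; refl; trans; cong; subst; subst₂) renaming (sym to ≡-sym)
open import Relation.Nullary using (¬_; Dec; yes; no; does; contradiction)
open import Relation.Nullary.Decidable using (True; toWitness; map′; _×-dec_; _⊎-dec_; _→-dec_; ¬?; dec-true; T?)

-- Decidable propositions and Boolean records

does-true⇒ : ∀ {A : Set} (a? : Dec A) → does a? ≡ true → A
does-true⇒ (yes a) _ = a

record-if : ∀ {A : Set} → Dec A → Bool → Maybe Bool → Maybe Bool
record-if a? b old = if does a? then just b else old

record-if-just : ∀ {A : Set} (a? : Dec A) {b c old} →
  record-if a? b old ≡ just c → (A × b ≡ c) ⊎ (old ≡ just c)
record-if-just (yes a) eq = inj₁ (a , just-injective eq)
record-if-just (no _)  eq = inj₂ eq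

-- Reordering a Hamilton cycle

module _ {n : ℕ} where

  Consec? : (i j : Fin n) → Dec (Consec i j)
  Consec? i j =
    (toℕ j ℕ.≟ suc (toℕ i)) ⊎-dec ((toℕ i ℕ.≟ n ∸ 1) ×-dec (toℕ j ℕ.≟ 0))

  OnCycle : Fin n ⤖ Fin n → Fin n → Fin n → Set
  OnCycle τ x y = ∃₂ λ i j → Consec i j × ((to i ≡ x × to j ≡ y) ⊎ (to i ≡ y × to j ≡ x))
    where open Bijection τ

  onCycle? : ∀ τ x y → Dec (OnCycle τ x y)
  onCycle? τ x y = any? λ i → any? λ j → Consec? i j ×-dec
    (((to i ≟ x) ×-dec (to j ≟ y)) ⊎-dec ((to i ≟ y) ×-dec (to j ≟ x)))
    where open Bijection τ

  -- A Hamilton cycle is a Boolean edge set here. Lying on the cycle is decidable over a finite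
  -- vertex set, so the decision procedure supplies that set, and its correctness gives both
  -- directions of the membership condition.
  cycleEdges-isHamCycle : ∀ (G : Graph n) τ → let open Bijection τ in
    (∀ i j → Consec i j → adj G (to i) (to j) ≡ true) →
    IsHamCycle G (λ x y → does (onCycle? τ x y))
  cycleEdges-isHamCycle G τ adjacent =
    τ , adjacent , λ x y → does-true⇒ (onCycle? τ x y) , dec-true (onCycle? τ x y)

  -- Composing the ordering `f` with `r` yields another Hamilton cycle. It uses the edge between
  -- `f (r i)` and `f (r j)`, which the old cycle avoids: `f` is injective and `r i`, `r j` are not
  -- consecutive in either direction.
  rearranged⇒¬unique : ∀ (G : Graph n) (ρ : Fin n ⤖ Fin n) → let r = Bijection.to ρ in
    (∃₂ λ i j → Consec i j × ¬ Consec (r i) (r j) × ¬ Consec (r j) (r i)) →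
    (u : UniquelyHamiltonian G) (let (_ , (σ , _) , _) = u; f = Bijection.to σ) →
    ¬ (∀ i j → Consec i j → adj G (f (r i)) (f (r j)) ≡ true)
  rearranged⇒¬unique G ρ (i , j , ij , ¬ij , ¬ji) (H , (σ , _ , H⇔) , unique) adjacent =
    notOnCycle (proj₁ (H⇔ x y) (trans (≡-sym (unique _ new x y)) xyNew))
    where
    open Bijection σ renaming (to to f)
    r = Bijection.to ρ
    τ = σ ⤖-∘ ρ
    x = f (r i)
    y = f (r j)
    new = cycleEdges-isHamCycle G τ adjacent
    xyNew : does (onCycle? τ x y) ≡ true
    xyNew = dec-true (onCycle? τ x y) (i , j , ij , inj₁ (refl , refl))
    notOnCycle : ¬ OnCycle σ x y
    notOnCycle (a , b , ab , inj₁ (p , q)) = ¬ij (subst₂ Consec (injective p) (injective q) ab)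
    notOnCycle (a , b , ab , inj₂ (p , q)) = ¬ji (subst₂ Consec (injective p) (injective q) ab)

-- Induced subgraphs

induced : ∀ {k n} → Graph n → (Fin k → Fin n) → Graph k
induced G e = record
  { adj    = λ x y → adj G (e x) (e y)
  ; sym    = λ x y → sym G (e x) (e y)
  ; irrefl = λ x → irrefl G (e x)
  }

induced-is42Graph : ∀ {k n} (G : Graph n) {e : Fin k → Fin n} → Injective _≡_ _≡_ e →
  4 ≤ k → Is42Graph G → Is42Graph (induced G e)
induced-is42Graph G inj 4≤k (_ , edges≥2) =
  4≤k , λ a b c d ab ac ad bc bd cd →
    edges≥2 _ _ _ _ (ab ∘ inj) (ac ∘ inj) (ad ∘ inj) (bc ∘ inj) (bd ∘ inj) (cd ∘ inj)

-- Windows of a cycle and decision trees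

-- A window is either an initial stretch 0, 1, …, k − 1 of the cycle (closed = false),
-- possibly of full length, or the whole cycle with its closing edge (closed = true).
module Window (k : ℕ) (closed : Bool) where

  Link : Fin k → Fin k → Set
  Link i j = (toℕ j ≡ suc (toℕ i)) ⊎ (T closed × toℕ i ≡ k ∸ 1 × toℕ j ≡ 0)

  Link? : (i j : Fin k) → Dec (Link i j)
  Link? i j = (toℕ j ℕ.≟ suc (toℕ i)) ⊎-dec
    (T? closed ×-dec ((toℕ i ℕ.≟ k ∸ 1) ×-dec (toℕ j ℕ.≟ 0)))

  End : Fin k → Set
  End i = (toℕ i ≡ 0) ⊎ (toℕ i ≡ k ∸ 1)

  -- The ends of an open window must stay in place because the rest of the cycle is attached there;
  -- a closed window has no such constraint. Newness is tested with `Consec` rather than `Link`: an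
  -- open window of full length has its two ends consecutive on the cycle.
  record Rearranges (p : Fin k → Fin k) : Set where
    constructor rearranges
    field
      injective  : ∀ i j → p i ≡ p j → i ≡ j
      surjective : ∀ y → ∃ λ x → p x ≡ y
      fixesEnds  : T closed ⊎ (∀ i → End i → p i ≡ i)
      newLink    : ∃₂ λ i j → Link i j × ¬ Consec (p i) (p j) × ¬ Consec (p j) (p i)

  rearranges? : ∀ p → Dec (Rearranges p)
  rearranges? p = map′ (λ (a , b , c , d) → rearranges a b c d)
    (λ (rearranges a b c d) → a , b , c , d)
    ((all? λ i → all? λ j → (p i ≟ p j) →-dec (i ≟ j)) ×-dec
     (all? λ y → any? λ x → p x ≟ y) ×-dec
     (T? closed ⊎-dec all? λ i → ((toℕ i ℕ.≟ 0) ⊎-dec (toℕ i ℕ.≟ k ∸ 1)) →-dec (p i ≟ i)) ×-dec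
     (any? λ i → any? λ j → Link? i j ×-dec ¬? (Consec? (p i) (p j)) ×-dec ¬? (Consec? (p j) (p i))))

  -- A partial adjacency matrix, with `nothing` for a pair not yet queried.
  Knowledge : Set
  Knowledge = Fin k → Fin k → Maybe Bool

  initially : Knowledge
  initially i j = record-if (Link? i j ⊎-dec Link? j i) true nothing

  samePair? : (x y i j : Fin k) → Dec ((x ≡ i × y ≡ j) ⊎ (x ≡ j × y ≡ i))
  samePair? x y i j = ((x ≟ i) ×-dec (y ≟ j)) ⊎-dec ((x ≟ j) ×-dec (y ≟ i))

  _[_,_↦_] : Knowledge → Fin k → Fin k → Bool → Knowledge
  (P [ i , j ↦ b ]) x y = record-if (samePair? x y i j) b (P x y)

  -- An undecided pair counts as an edge, so that the sums bound the true number of edges from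
  -- above.
  possible : Maybe Bool → ℕ
  possible (just b) = b2n b
  possible nothing  = 1

  possibleEdges : Knowledge → (a b c d : Fin k) → ℕ
  possibleEdges P a b c d =
    possible (P a b) + possible (P a c) + possible (P a d)
    + possible (P b c) + possible (P b d) + possible (P c d)

  Along : Knowledge → (Fin k → Fin k) → Set
  Along P p = ∀ i j → Link i j → P (p i) (p j) ≡ just true

  along? : ∀ P p → Dec (Along P p)
  along? P p = all? λ i → all? λ j → Link? i j →-dec ≡-dec Bool._≟_ (P (p i) (p j)) (just true)

  -- A decision tree on adjacencies, each leaf of which exhibits four vertices
  -- spanning at most one edge or a rearrangement of the window along known edges.
  data Tree (P : Knowledge) : Set where
    split  : ∀ i j → Tree (P [ i , j ↦ true ]) → Tree (P [ i , j ↦ false ]) → Tree P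
    sparse : ∀ a b c d {_ : True (a <? b)} {_ : True (b <? c)} {_ : True (c <? d)}
             {_ : True (possibleEdges P a b c d ≤? 1)} → Tree P
    detour : ∀ (p : Vec (Fin k) k) {_ : True (rearranges? (lookup p))}
             {_ : True (along? P (lookup p))} → Tree P

  -- Puts the absent case first. When absence is refuted at once by a `sparse` leaf, the chain of
  -- `$` can then continue with the chord present.
  split⁻ : ∀ {P} i j → Tree (P [ i , j ↦ false ]) → Tree (P [ i , j ↦ true ]) → Tree P
  split⁻ i j u t = split i j t u

  HasDetour : Graph k → Set
  HasDetour W = ∃ λ p → Rearranges p × (∀ i j → Link i j → adj W (p i) (p j) ≡ true)

  module _ (W : Graph k) where

    Agrees : Knowledge → Set
    Agrees P = ∀ i j {b} → P i j ≡ just b → adj W i j ≡ b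

    agrees-initially : (∀ i j → Link i j → adj W i j ≡ true) → Agrees initially
    agrees-initially linked i j eq with record-if-just (Link? i j ⊎-dec Link? j i) eq
    ... | inj₁ (inj₁ ij , refl) = linked i j ij
    ... | inj₁ (inj₂ ji , refl) = trans (sym W i j) (linked j i ji)

    agrees-update : ∀ {P} i j {b} → Agrees P → adj W i j ≡ b → Agrees (P [ i , j ↦ b ])
    agrees-update i j agrees ij x y eq with record-if-just (samePair? x y i j) eq
    ... | inj₁ (inj₁ (refl , refl) , refl) = ij
    ... | inj₁ (inj₂ (refl , refl) , refl) = trans (sym W x y) ij
    ... | inj₂ old = agrees x y old

    b2n≤possible : ∀ {P} → Agrees P → ∀ i j → b2n (adj W i j) ≤ possible (P i j)
    b2n≤possible {P} agrees i j with P i j in eq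
    ... | just b rewrite agrees i j eq = ℕ.≤-refl
    ... | nothing with adj W i j
    ...   | true  = ℕ.≤-refl
    ...   | false = z≤n

    edges4≤possibleEdges : ∀ {P} → Agrees P → ∀ a b c d →
      edges4 W a b c d ≤ possibleEdges P a b c d
    edges4≤possibleEdges {P} agrees a b c d =
      (((((≤p a b ⊕ ≤p a c) ⊕ ≤p a d) ⊕ ≤p b c) ⊕ ≤p b d) ⊕ ≤p c d)
      where
      ≤p = b2n≤possible agrees
      _⊕_ = ℕ.+-mono-≤

    -- The actual adjacencies of `W` select one branch of the tree. It cannot end in a `sparse`
    -- leaf, whose four vertices are distinct by their strict order and span at most one edge, so it
    -- ends in a `detour`.
    tree⇒detour : ∀ {P} → Tree P → Is42Graph W → Agrees P → HasDetour W
    tree⇒detour (split i j t u) is42 agrees with adj W i j in eq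
    ... | true  = tree⇒detour t is42 (agrees-update i j agrees eq)
    ... | false = tree⇒detour u is42 (agrees-update i j agrees eq)
    tree⇒detour (sparse a b c d {a<b} {b<c} {c<d} {few}) (_ , edges≥2) agrees =
      contradiction
        (edges≥2 a b c d (<⇒≢ ab) (<⇒≢ (<-trans ab bc)) (<⇒≢ (<-trans ab (<-trans bc cd)))
          (<⇒≢ bc) (<⇒≢ (<-trans bc cd)) (<⇒≢ cd))
        (ℕ.<⇒≱ (s≤s (ℕ.≤-trans (edges4≤possibleEdges agrees a b c d) (toWitness few))))
      where
      ab = toWitness a<b
      bc = toWitness b<c
      cd = toWitness c<d
    tree⇒detour (detour p {r} {along}) is42 agrees =
      lookup p , toWitness r , λ i j ij → agrees _ _ (toWitness along i j ij)

-- From a window to the whole cycle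

module _ (k m : ℕ) (closed : Bool) (closed⇒whole : T closed → m ≡ 0) where
  open Window k closed

  -- Only the closing link needs care: a closed window leaves no vertex outside, so its last index
  -- is also the last index of the cycle.
  Link⇒Consec : ∀ i j → Link i j → Consec (i ↑ˡ m) (j ↑ˡ m)
  Link⇒Consec i j l rewrite toℕ-↑ˡ i m | toℕ-↑ˡ j m = case l of λ where
    (inj₁ next) → inj₁ next
    (inj₂ (c , last , first)) → case closed⇒whole c of λ where
      refl → inj₂ (trans last (cong (_∸ 1) (≡-sym (ℕ.+-identityʳ k))) , first)

  Consec-↑ˡ⁻ : ∀ i j → Consec (i ↑ˡ m) (j ↑ˡ m) → Consec i j
  Consec-↑ˡ⁻ i j c rewrite toℕ-↑ˡ i m | toℕ-↑ˡ j m = case c of λ where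
      (inj₁ next) → inj₁ next
      (inj₂ (last , first)) → inj₂ (isLast m last , first)
    where
    isLast : ∀ m → toℕ i ≡ k + m ∸ 1 → toℕ i ≡ k ∸ 1
    isLast zero    last = trans last (cong (_∸ 1) (ℕ.+-identityʳ k))
    -- With vertices outside the window, the last index of the cycle is at least `k`, which no
    -- window index reaches.
    isLast (suc m) last = contradiction (toℕ<n i)
      (ℕ.≤⇒≯ (subst (k ≤_) (≡-sym (trans last (cong (_∸ 1) (ℕ.+-suc k m)))) (ℕ.m≤m+n k m)))

  -- The sole exception to being a link is the wrap-around pair of an open window, and it consists
  -- of the two ends.
  Consec⇒Link : ∀ i j → Consec i j → Link i j ⊎ (¬ T closed × End i × End j)
  Consec⇒Link i j (inj₁ next) = inj₁ (inj₁ next)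
  Consec⇒Link i j (inj₂ (last , first)) with T? closed
  ... | yes c = inj₁ (inj₂ (c , last , first))
  ... | no ¬c = inj₂ (¬c , inj₂ last , inj₁ first)

  -- A successor of value at least `k` forces index `k ∸ 1`; wrapping around would land on 0, which
  -- lies inside the window.
  leaves⇒End : ∀ i j → Consec (i ↑ˡ m) (k ↑ʳ j) → End i
  leaves⇒End i j c rewrite toℕ-↑ˡ i m | toℕ-↑ʳ k j = case c of λ where
    (inj₁ next) → inj₂ (cong (_∸ 1) (ℕ.≤-antisym (toℕ<n i) (subst (k ≤_) next (ℕ.m≤m+n k (toℕ j)))))
    (inj₂ (_ , first)) → contradiction
      (ℕ.≤-trans (toℕ<n i) (subst (k ≤_) first (ℕ.m≤m+n k (toℕ j)))) λ ()

  -- Indices outside are at least `k`, so the cycle can re-enter only by wrapping around to 0.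
  enters⇒End : ∀ i j → Consec (k ↑ʳ i) (j ↑ˡ m) → End j
  enters⇒End i j c rewrite toℕ-↑ˡ j m | toℕ-↑ʳ k i = case c of λ where
    (inj₁ next) → contradiction (toℕ<n j)
      (ℕ.≤⇒≯ (subst (k ≤_) (≡-sym next) (ℕ.m≤n⇒m≤1+n (ℕ.m≤m+n k (toℕ i)))))
    (inj₂ (_ , first)) → inj₁ first

  extend : (p : Fin k → Fin k) → Rearranges p → Fin (k + m) ⤖ Fin (k + m)
  extend p r = ↔⇒⤖ (↔-sym +↔⊎) ⤖-∘ ((onWindow ⊎-⤖ ⤖-id (Fin m)) ⤖-∘ ↔⇒⤖ +↔⊎)
    where
    open Rearranges r
    onWindow : Fin k ⤖ Fin k
    onWindow = mk⤖ ((λ {i} {j} → injective i j) ,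
      λ y → let (x , px≡y) = surjective y in x , λ { refl → px≡y })

  module _ {p : Fin k → Fin k} (r : Rearranges p) where

    open Bijection (extend p r) renaming (to to ext)

    fixes : ¬ T closed → ∀ i → End i → p i ≡ i
    fixes ¬c with Rearranges.fixesEnds r
    ... | inj₁ c   = contradiction c ¬c
    ... | inj₂ fix = fix

    outside⇒open : Fin m → ¬ T closed
    outside⇒open i c with refl ← closed⇒whole c = case i of λ ()

    ext-↑ˡ : ∀ i → ext (i ↑ˡ m) ≡ p i ↑ˡ m
    ext-↑ˡ i rewrite splitAt-↑ˡ k i m = refl

    -- The rearranged cycle leaves the window only through its fixed ends.
    ext-consec : ∀ i j → Consec i j →
      (∃₂ λ a b → Link a b × ext i ≡ p a ↑ˡ m × ext j ≡ p b ↑ˡ m) ⊎ Consec (ext i) (ext j)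
    ext-consec i j c with splitAt k i in eqi | splitAt k j in eqj
    ... | inj₁ a | inj₂ b
      rewrite ≡-sym (splitAt⁻¹-↑ˡ eqi) | ≡-sym (splitAt⁻¹-↑ʳ eqj)
            | fixes (outside⇒open b) a (leaves⇒End a b c)
      = inj₂ c
    ... | inj₂ a | inj₁ b
      rewrite ≡-sym (splitAt⁻¹-↑ʳ eqi) | ≡-sym (splitAt⁻¹-↑ˡ eqj)
            | fixes (outside⇒open a) b (enters⇒End a b c)
      = inj₂ c
    ... | inj₂ a | inj₂ b
      rewrite splitAt⁻¹-↑ʳ eqi | splitAt⁻¹-↑ʳ eqj
      = inj₂ c
    ... | inj₁ a | inj₁ b
      rewrite ≡-sym (splitAt⁻¹-↑ˡ eqi) | ≡-sym (splitAt⁻¹-↑ˡ eqj)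
      with Consec⇒Link a b (Consec-↑ˡ⁻ a b c)
    ...   | inj₁ ab = inj₁ (a , b , ab , refl , refl)
    ...   | inj₂ (¬c , enda , endb) rewrite fixes ¬c a enda | fixes ¬c b endb = inj₂ c

  -- Each step of the extended ordering is either a link supplied by the detour or an old cycle
  -- edge. The new link stays new in the whole cycle because `Consec-↑ˡ⁻` pulls consecutive pairs
  -- back to the window.
  detour⇒¬unique : (G : Graph (k + m)) (u : UniquelyHamiltonian G)
    (let (_ , (σ , _) , _) = u) → ¬ HasDetour (induced G (λ i → Bijection.to σ (i ↑ˡ m)))
  detour⇒¬unique G u@(_ , (σ , onG , _) , _) (p , r , along) =
    rearranged⇒¬unique G (extend p r)
      (let (i , j , ij , ¬ij , ¬ji) = Rearranges.newLink r
       in i ↑ˡ m , j ↑ˡ m , Link⇒Consec i j ij , ¬ij ∘ old i j , ¬ji ∘ old j i)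
      u adjacent
    where
    open Bijection σ renaming (to to f)
    open Bijection (extend p r) renaming (to to ext)
    old : ∀ i j → Consec (ext (i ↑ˡ m)) (ext (j ↑ˡ m)) → Consec (p i) (p j)
    old i j = Consec-↑ˡ⁻ (p i) (p j) ∘ subst₂ Consec (ext-↑ˡ r i) (ext-↑ˡ r j)
    adjacent : ∀ i j → Consec i j → adj G (f (ext i)) (f (ext j)) ≡ true
    adjacent i j c with ext-consec r i j c
    ... | inj₁ (a , b , ab , eqi , eqj) rewrite eqi | eqj = along a b ab
    ... | inj₂ c′ = onG _ _ c′

  -- Window links are cycle edges, hence edges of `G`; this makes the initial knowledge correct, and
  -- the tree then delivers a detour.
  tree⇒¬unique : 4 ≤ k → Tree initially → (G : Graph (k + m)) → Is42Graph G →
    ¬ UniquelyHamiltonian G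
  tree⇒¬unique 4≤k tree G is42 u@(_ , (σ , onG , _) , _) =
    detour⇒¬unique G u
      (tree⇒detour W tree (induced-is42Graph G (λ eq → ↑ˡ-injective m _ _ (injective eq)) 4≤k is42)
        (agrees-initially W λ i j → onG _ _ ∘ Link⇒Consec i j))
    where
    open Bijection σ
    W = induced G (λ i → to (i ↑ˡ m))

-- The decision tree for a spanning 8-cycle

module _ where
  open Window 8 true

  -- Numbers are positions along the cycle. The recurring quadruples 0, 2, 4, 6 and 1, 3, 5, 7
  -- contain no edge of the 8-cycle, so each must span two chords.
  cycle₈ : Tree initially
  cycle₈ =
    split 3F 5F (
      -- The basic exchange: chords from i to j and from i + 1 to j + 1 allow the stretch from i + 1
      -- to j to be traversed backwards. Here i = 2 and j = 4.
      split 2F 4F (detour (0F ∷ 1F ∷ 2F ∷ 4F ∷ 3F ∷ 5F ∷ 6F ∷ 7F ∷ [])) $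
      split 4F 6F (detour (0F ∷ 1F ∷ 2F ∷ 3F ∷ 5F ∷ 4F ∷ 6F ∷ 7F ∷ [])) $
      split 1F 4F (
        split 0F 4F (detour (0F ∷ 4F ∷ 1F ∷ 2F ∷ 3F ∷ 5F ∷ 6F ∷ 7F ∷ [])) $
        split 2F 6F (detour (0F ∷ 1F ∷ 4F ∷ 5F ∷ 3F ∷ 2F ∷ 6F ∷ 7F ∷ [])) $
        split 0F 2F (detour (0F ∷ 2F ∷ 1F ∷ 4F ∷ 3F ∷ 5F ∷ 6F ∷ 7F ∷ [])) $
        sparse 0F 2F 4F 6F) $
      split 1F 7F (
        -- The same exchange across the closing edge, with i = 1 and j = 7. The new cycle closes
        -- along the chord 2 0, so the last vertex moves.
        split 0F 2F (detour (0F ∷ 1F ∷ 7F ∷ 6F ∷ 5F ∷ 4F ∷ 3F ∷ 2F ∷ [])) $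
        split 0F 6F (detour (0F ∷ 6F ∷ 5F ∷ 4F ∷ 3F ∷ 2F ∷ 1F ∷ 7F ∷ [])) $
        split⁻ 0F 4F (sparse 0F 2F 4F 6F) $
        split 2F 6F (detour (0F ∷ 1F ∷ 7F ∷ 6F ∷ 2F ∷ 3F ∷ 5F ∷ 4F ∷ [])) $
        sparse 0F 2F 4F 6F) $
      split 4F 7F (
        split 0F 4F (detour (0F ∷ 1F ∷ 2F ∷ 3F ∷ 5F ∷ 6F ∷ 7F ∷ 4F ∷ [])) $
        split 0F 6F (detour (0F ∷ 1F ∷ 2F ∷ 3F ∷ 5F ∷ 4F ∷ 7F ∷ 6F ∷ [])) $
        split 2F 6F (detour (0F ∷ 1F ∷ 2F ∷ 6F ∷ 5F ∷ 3F ∷ 4F ∷ 7F ∷ [])) $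
        sparse 0F 2F 4F 6F) $
      split⁻ 1F 6F (sparse 1F 4F 6F 7F) $
      split 2F 7F (detour (0F ∷ 1F ∷ 6F ∷ 5F ∷ 4F ∷ 3F ∷ 2F ∷ 7F ∷ [])) $
      sparse 1F 2F 4F 7F) $
    split 1F 3F (
      split 2F 4F (detour (0F ∷ 1F ∷ 3F ∷ 2F ∷ 4F ∷ 5F ∷ 6F ∷ 7F ∷ [])) $
      split 0F 2F (detour (0F ∷ 2F ∷ 1F ∷ 3F ∷ 4F ∷ 5F ∷ 6F ∷ 7F ∷ [])) $
      split 0F 4F (
        split 3F 7F (detour (0F ∷ 1F ∷ 2F ∷ 3F ∷ 7F ∷ 6F ∷ 5F ∷ 4F ∷ [])) $
        split 2F 7F (detour (0F ∷ 1F ∷ 3F ∷ 2F ∷ 7F ∷ 6F ∷ 5F ∷ 4F ∷ [])) $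
        split 2F 5F (detour (0F ∷ 4F ∷ 3F ∷ 1F ∷ 2F ∷ 5F ∷ 6F ∷ 7F ∷ [])) $
        split⁻ 5F 7F (sparse 2F 3F 5F 7F) $
        split 0F 6F (detour (0F ∷ 1F ∷ 2F ∷ 3F ∷ 4F ∷ 5F ∷ 7F ∷ 6F ∷ [])) $
        split 2F 6F (detour (0F ∷ 1F ∷ 3F ∷ 2F ∷ 6F ∷ 7F ∷ 5F ∷ 4F ∷ [])) $
        split 4F 6F (detour (0F ∷ 1F ∷ 2F ∷ 3F ∷ 4F ∷ 6F ∷ 5F ∷ 7F ∷ [])) $
        sparse 0F 2F 4F 6F) $
      split 4F 7F (
        split 0F 5F (detour (0F ∷ 1F ∷ 2F ∷ 3F ∷ 4F ∷ 7F ∷ 6F ∷ 5F ∷ [])) $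
        split 2F 6F (detour (0F ∷ 1F ∷ 3F ∷ 2F ∷ 6F ∷ 5F ∷ 4F ∷ 7F ∷ [])) $
        split⁻ 2F 5F (sparse 0F 2F 4F 5F) $
        split 0F 6F (detour (0F ∷ 1F ∷ 3F ∷ 2F ∷ 5F ∷ 4F ∷ 7F ∷ 6F ∷ [])) $
        sparse 0F 2F 4F 6F) $
      split⁻ 2F 7F (sparse 0F 2F 4F 7F) $
      split 0F 6F (detour (0F ∷ 6F ∷ 5F ∷ 4F ∷ 3F ∷ 1F ∷ 2F ∷ 7F ∷ [])) $
      split 2F 6F (detour (0F ∷ 1F ∷ 3F ∷ 4F ∷ 5F ∷ 6F ∷ 2F ∷ 7F ∷ [])) $
      sparse 0F 2F 4F 6F) $
    split 0F 6F (
      split 5F 7F (detour (0F ∷ 1F ∷ 2F ∷ 3F ∷ 4F ∷ 5F ∷ 7F ∷ 6F ∷ [])) $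
      split 1F 7F (detour (0F ∷ 6F ∷ 5F ∷ 4F ∷ 3F ∷ 2F ∷ 1F ∷ 7F ∷ [])) $
      split⁻ 3F 7F (sparse 1F 3F 5F 7F) $
      split⁻ 1F 5F (sparse 1F 3F 5F 7F) $
      split 0F 4F (detour (0F ∷ 4F ∷ 3F ∷ 2F ∷ 1F ∷ 5F ∷ 6F ∷ 7F ∷ [])) $
      split 2F 6F (detour (0F ∷ 1F ∷ 2F ∷ 6F ∷ 5F ∷ 4F ∷ 3F ∷ 7F ∷ [])) $
      split 4F 6F (detour (0F ∷ 6F ∷ 4F ∷ 5F ∷ 1F ∷ 2F ∷ 3F ∷ 7F ∷ [])) $
      split 0F 2F (detour (0F ∷ 2F ∷ 1F ∷ 5F ∷ 4F ∷ 3F ∷ 7F ∷ 6F ∷ [])) $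
      split 2F 4F (detour (0F ∷ 1F ∷ 5F ∷ 4F ∷ 2F ∷ 3F ∷ 7F ∷ 6F ∷ [])) $
      sparse 0F 2F 4F 6F) $
    split 2F 6F (
      split 3F 7F (detour (0F ∷ 1F ∷ 2F ∷ 6F ∷ 5F ∷ 4F ∷ 3F ∷ 7F ∷ [])) $
      split 1F 5F (detour (0F ∷ 1F ∷ 5F ∷ 4F ∷ 3F ∷ 2F ∷ 6F ∷ 7F ∷ [])) $
      split⁻ 5F 7F (sparse 1F 3F 5F 7F) $
      split 4F 6F (detour (0F ∷ 1F ∷ 2F ∷ 3F ∷ 4F ∷ 6F ∷ 5F ∷ 7F ∷ [])) $
      split⁻ 1F 7F (sparse 1F 3F 5F 7F) $
      split 3F 6F (detour (0F ∷ 1F ∷ 2F ∷ 6F ∷ 3F ∷ 4F ∷ 5F ∷ 7F ∷ [])) $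
      split 0F 3F (detour (0F ∷ 3F ∷ 4F ∷ 5F ∷ 6F ∷ 2F ∷ 1F ∷ 7F ∷ [])) $
      split 0F 4F (detour (0F ∷ 1F ∷ 7F ∷ 5F ∷ 6F ∷ 2F ∷ 3F ∷ 4F ∷ [])) $
      sparse 0F 3F 4F 6F) $
    split 0F 4F (
      split 1F 5F (detour (0F ∷ 4F ∷ 3F ∷ 2F ∷ 1F ∷ 5F ∷ 6F ∷ 7F ∷ [])) $
      split 3F 7F (detour (0F ∷ 1F ∷ 2F ∷ 3F ∷ 7F ∷ 6F ∷ 5F ∷ 4F ∷ [])) $
      split⁻ 1F 7F (sparse 1F 3F 5F 7F) $
      split 0F 3F (detour (0F ∷ 3F ∷ 2F ∷ 1F ∷ 7F ∷ 6F ∷ 5F ∷ 4F ∷ [])) $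
      split 0F 5F (detour (0F ∷ 4F ∷ 3F ∷ 2F ∷ 1F ∷ 7F ∷ 6F ∷ 5F ∷ [])) $
      sparse 0F 1F 3F 5F) $
    split 2F 4F (
      split 0F 3F (
        split 1F 5F (detour (0F ∷ 3F ∷ 4F ∷ 2F ∷ 1F ∷ 5F ∷ 6F ∷ 7F ∷ [])) $
        split 3F 7F (detour (0F ∷ 1F ∷ 2F ∷ 4F ∷ 5F ∷ 6F ∷ 7F ∷ 3F ∷ [])) $
        split 1F 7F (detour (0F ∷ 1F ∷ 7F ∷ 6F ∷ 5F ∷ 4F ∷ 2F ∷ 3F ∷ [])) $
        sparse 1F 3F 5F 7F) $
      split 3F 6F (
        split 1F 5F (detour (0F ∷ 1F ∷ 5F ∷ 4F ∷ 2F ∷ 3F ∷ 6F ∷ 7F ∷ [])) $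
        split 3F 7F (detour (0F ∷ 1F ∷ 2F ∷ 4F ∷ 5F ∷ 6F ∷ 3F ∷ 7F ∷ [])) $
        split 5F 7F (detour (0F ∷ 1F ∷ 2F ∷ 4F ∷ 3F ∷ 6F ∷ 5F ∷ 7F ∷ [])) $
        sparse 1F 3F 5F 7F) $
      split⁻ 0F 5F (sparse 0F 3F 5F 6F) $
      split⁻ 4F 6F (sparse 0F 3F 4F 6F) $
      split 1F 5F (detour (0F ∷ 5F ∷ 1F ∷ 2F ∷ 3F ∷ 4F ∷ 6F ∷ 7F ∷ [])) $
      split 1F 6F (detour (0F ∷ 5F ∷ 4F ∷ 3F ∷ 2F ∷ 1F ∷ 6F ∷ 7F ∷ [])) $
      sparse 1F 3F 5F 6F) $
    -- All chords between 0, 2 and 4, 6 are now absent, which forces both 0 2 and 4 6.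
    split⁻ 0F 2F (sparse 0F 2F 4F 6F) $
    split⁻ 4F 6F (sparse 0F 2F 4F 6F) $
    split 5F 7F (detour (0F ∷ 1F ∷ 2F ∷ 3F ∷ 4F ∷ 6F ∷ 5F ∷ 7F ∷ [])) $
    split 1F 7F (detour (0F ∷ 1F ∷ 7F ∷ 6F ∷ 5F ∷ 4F ∷ 3F ∷ 2F ∷ [])) $
    -- Among the odd positions only 1 5 and 3 7 remain possible, so both are needed; together with 0
    -- 2 and 4 6 they give the last detour.
    split⁻ 3F 7F (sparse 1F 3F 5F 7F) $
    split 1F 5F (detour (0F ∷ 1F ∷ 5F ∷ 4F ∷ 6F ∷ 7F ∷ 3F ∷ 2F ∷ [])) $
    sparse 1F 3F 5F 7F

-- The decision tree for a path on nine vertices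

module _ where
  open Window 9 false

  -- Every detour starts at 0 and ends at 8, as an open window requires. Nothing is assumed about
  -- the pair 0 8, so the tree serves every order from nine on.
  path₉ : Tree initially
  path₉ =
    split 4F 6F (
      split 5F 7F (detour (0F ∷ 1F ∷ 2F ∷ 3F ∷ 4F ∷ 6F ∷ 5F ∷ 7F ∷ 8F ∷ [])) $
      split 3F 5F (detour (0F ∷ 1F ∷ 2F ∷ 3F ∷ 5F ∷ 4F ∷ 6F ∷ 7F ∷ 8F ∷ [])) $
      split 2F 7F (
        split 3F 8F (detour (0F ∷ 1F ∷ 2F ∷ 7F ∷ 6F ∷ 5F ∷ 4F ∷ 3F ∷ 8F ∷ [])) $
        split 1F 5F (detour (0F ∷ 1F ∷ 5F ∷ 6F ∷ 4F ∷ 3F ∷ 2F ∷ 7F ∷ 8F ∷ [])) $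
        split 5F 8F (
          split 3F 7F (detour (0F ∷ 1F ∷ 2F ∷ 3F ∷ 7F ∷ 6F ∷ 4F ∷ 5F ∷ 8F ∷ [])) $
          split 1F 3F (detour (0F ∷ 1F ∷ 3F ∷ 2F ∷ 7F ∷ 6F ∷ 4F ∷ 5F ∷ 8F ∷ [])) $
          sparse 1F 3F 5F 7F) $
        split⁻ 1F 3F (sparse 1F 3F 5F 8F) $
        split 2F 8F (detour (0F ∷ 1F ∷ 3F ∷ 4F ∷ 5F ∷ 6F ∷ 7F ∷ 2F ∷ 8F ∷ [])) $
        split 2F 5F (detour (0F ∷ 1F ∷ 3F ∷ 2F ∷ 5F ∷ 4F ∷ 6F ∷ 7F ∷ 8F ∷ [])) $
        sparse 2F 3F 5F 8F) $
      split 2F 5F (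
        split 1F 5F (detour (0F ∷ 1F ∷ 5F ∷ 2F ∷ 3F ∷ 4F ∷ 6F ∷ 7F ∷ 8F ∷ [])) $
        split 3F 7F (detour (0F ∷ 1F ∷ 2F ∷ 5F ∷ 6F ∷ 4F ∷ 3F ∷ 7F ∷ 8F ∷ [])) $
        split 1F 3F (detour (0F ∷ 1F ∷ 3F ∷ 2F ∷ 5F ∷ 4F ∷ 6F ∷ 7F ∷ 8F ∷ [])) $
        sparse 1F 3F 5F 7F) $
      split⁻ 3F 7F (sparse 2F 3F 5F 7F) $
      split 5F 8F (detour (0F ∷ 1F ∷ 2F ∷ 3F ∷ 7F ∷ 6F ∷ 4F ∷ 5F ∷ 8F ∷ [])) $
      split⁻ 2F 8F (sparse 2F 5F 7F 8F) $
      split 1F 5F (detour (0F ∷ 1F ∷ 5F ∷ 4F ∷ 6F ∷ 7F ∷ 3F ∷ 2F ∷ 8F ∷ [])) $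
      split 1F 7F (detour (0F ∷ 1F ∷ 7F ∷ 6F ∷ 5F ∷ 4F ∷ 3F ∷ 2F ∷ 8F ∷ [])) $
      sparse 1F 2F 5F 7F) $
    split 3F 7F (
      split 4F 8F (detour (0F ∷ 1F ∷ 2F ∷ 3F ∷ 7F ∷ 6F ∷ 5F ∷ 4F ∷ 8F ∷ [])) $
      split 2F 6F (detour (0F ∷ 1F ∷ 2F ∷ 6F ∷ 5F ∷ 4F ∷ 3F ∷ 7F ∷ 8F ∷ [])) $
      split 2F 4F (
        split 3F 6F (detour (0F ∷ 1F ∷ 2F ∷ 4F ∷ 5F ∷ 6F ∷ 3F ∷ 7F ∷ 8F ∷ [])) $
        split 1F 6F (detour (0F ∷ 1F ∷ 6F ∷ 5F ∷ 4F ∷ 2F ∷ 3F ∷ 7F ∷ 8F ∷ [])) $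
        split 3F 5F (detour (0F ∷ 1F ∷ 2F ∷ 4F ∷ 3F ∷ 5F ∷ 6F ∷ 7F ∷ 8F ∷ [])) $
        split 1F 3F (detour (0F ∷ 1F ∷ 3F ∷ 2F ∷ 4F ∷ 5F ∷ 6F ∷ 7F ∷ 8F ∷ [])) $
        split⁻ 1F 5F (sparse 1F 3F 5F 6F) $
        split 0F 3F (detour (0F ∷ 3F ∷ 4F ∷ 2F ∷ 1F ∷ 5F ∷ 6F ∷ 7F ∷ 8F ∷ [])) $
        split 0F 6F (detour (0F ∷ 6F ∷ 5F ∷ 1F ∷ 2F ∷ 4F ∷ 3F ∷ 7F ∷ 8F ∷ [])) $
        sparse 0F 1F 3F 6F) $
      split⁻ 6F 8F (sparse 2F 4F 6F 8F) $
      split 2F 7F (detour (0F ∷ 1F ∷ 2F ∷ 7F ∷ 3F ∷ 4F ∷ 5F ∷ 6F ∷ 8F ∷ [])) $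
      split 4F 7F (detour (0F ∷ 1F ∷ 2F ∷ 3F ∷ 7F ∷ 4F ∷ 5F ∷ 6F ∷ 8F ∷ [])) $
      sparse 2F 4F 6F 7F) $
    split 1F 3F (
      split 2F 4F (detour (0F ∷ 1F ∷ 3F ∷ 2F ∷ 4F ∷ 5F ∷ 6F ∷ 7F ∷ 8F ∷ [])) $
      split 0F 2F (detour (0F ∷ 2F ∷ 1F ∷ 3F ∷ 4F ∷ 5F ∷ 6F ∷ 7F ∷ 8F ∷ [])) $
      split 2F 6F (
        split 2F 5F (detour (0F ∷ 1F ∷ 3F ∷ 4F ∷ 5F ∷ 2F ∷ 6F ∷ 7F ∷ 8F ∷ [])) $
        split 0F 5F (detour (0F ∷ 5F ∷ 4F ∷ 3F ∷ 1F ∷ 2F ∷ 6F ∷ 7F ∷ 8F ∷ [])) $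
        split 2F 7F (detour (0F ∷ 1F ∷ 3F ∷ 4F ∷ 5F ∷ 6F ∷ 2F ∷ 7F ∷ 8F ∷ [])) $
        split 4F 7F (detour (0F ∷ 1F ∷ 3F ∷ 2F ∷ 6F ∷ 5F ∷ 4F ∷ 7F ∷ 8F ∷ [])) $
        split⁻ 0F 7F (sparse 0F 2F 5F 7F) $
        split 2F 8F (detour (0F ∷ 7F ∷ 6F ∷ 5F ∷ 4F ∷ 3F ∷ 1F ∷ 2F ∷ 8F ∷ [])) $
        split⁻ 4F 8F (sparse 2F 4F 7F 8F) $
        split 5F 7F (detour (0F ∷ 1F ∷ 3F ∷ 2F ∷ 6F ∷ 7F ∷ 5F ∷ 4F ∷ 8F ∷ [])) $
        sparse 2F 4F 5F 7F) $
      split⁻ 0F 4F (sparse 0F 2F 4F 6F) $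
      split 2F 5F (detour (0F ∷ 4F ∷ 3F ∷ 1F ∷ 2F ∷ 5F ∷ 6F ∷ 7F ∷ 8F ∷ [])) $
      split⁻ 0F 6F (sparse 0F 2F 4F 6F) $
      split 1F 5F (detour (0F ∷ 4F ∷ 3F ∷ 2F ∷ 1F ∷ 5F ∷ 6F ∷ 7F ∷ 8F ∷ [])) $
      split 2F 7F (detour (0F ∷ 6F ∷ 5F ∷ 4F ∷ 3F ∷ 1F ∷ 2F ∷ 7F ∷ 8F ∷ [])) $
      split⁻ 4F 7F (sparse 2F 4F 6F 7F) $
      split 5F 8F (detour (0F ∷ 1F ∷ 2F ∷ 3F ∷ 4F ∷ 7F ∷ 6F ∷ 5F ∷ 8F ∷ [])) $
      split 1F 7F (detour (0F ∷ 6F ∷ 5F ∷ 4F ∷ 3F ∷ 2F ∷ 1F ∷ 7F ∷ 8F ∷ [])) $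
      split⁻ 5F 7F (sparse 1F 2F 5F 7F) $
      split 1F 8F (detour (0F ∷ 6F ∷ 7F ∷ 5F ∷ 4F ∷ 3F ∷ 2F ∷ 1F ∷ 8F ∷ [])) $
      split 2F 8F (detour (0F ∷ 6F ∷ 7F ∷ 5F ∷ 4F ∷ 3F ∷ 1F ∷ 2F ∷ 8F ∷ [])) $
      sparse 1F 2F 5F 8F) $
    split 1F 7F (
      split 0F 6F (detour (0F ∷ 6F ∷ 5F ∷ 4F ∷ 3F ∷ 2F ∷ 1F ∷ 7F ∷ 8F ∷ [])) $
      split 3F 6F (
        split 4F 7F (detour (0F ∷ 1F ∷ 2F ∷ 3F ∷ 6F ∷ 5F ∷ 4F ∷ 7F ∷ 8F ∷ [])) $
        split 0F 4F (detour (0F ∷ 4F ∷ 5F ∷ 6F ∷ 3F ∷ 2F ∷ 1F ∷ 7F ∷ 8F ∷ [])) $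
        split⁻ 0F 7F (sparse 0F 4F 6F 7F) $
        split 6F 8F (detour (0F ∷ 7F ∷ 1F ∷ 2F ∷ 3F ∷ 4F ∷ 5F ∷ 6F ∷ 8F ∷ [])) $
        split 4F 8F (detour (0F ∷ 7F ∷ 1F ∷ 2F ∷ 3F ∷ 6F ∷ 5F ∷ 4F ∷ 8F ∷ [])) $
        sparse 0F 4F 6F 8F) $
      split 0F 3F (
        split 1F 4F (detour (0F ∷ 3F ∷ 2F ∷ 1F ∷ 4F ∷ 5F ∷ 6F ∷ 7F ∷ 8F ∷ [])) $
        split 2F 6F (detour (0F ∷ 3F ∷ 4F ∷ 5F ∷ 6F ∷ 2F ∷ 1F ∷ 7F ∷ 8F ∷ [])) $
        split⁻ 1F 6F (sparse 1F 3F 4F 6F) $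
        split 0F 5F (detour (0F ∷ 5F ∷ 4F ∷ 3F ∷ 2F ∷ 1F ∷ 6F ∷ 7F ∷ 8F ∷ [])) $
        split 0F 2F (detour (0F ∷ 2F ∷ 3F ∷ 4F ∷ 5F ∷ 6F ∷ 1F ∷ 7F ∷ 8F ∷ [])) $
        split 2F 5F (detour (0F ∷ 3F ∷ 4F ∷ 5F ∷ 2F ∷ 1F ∷ 6F ∷ 7F ∷ 8F ∷ [])) $
        sparse 0F 2F 5F 6F) $
      split⁻ 0F 7F (sparse 0F 3F 6F 7F) $
      split⁻ 0F 4F (sparse 0F 3F 4F 6F) $
      split 3F 8F (detour (0F ∷ 4F ∷ 5F ∷ 6F ∷ 7F ∷ 1F ∷ 2F ∷ 3F ∷ 8F ∷ [])) $
      split 6F 8F (detour (0F ∷ 7F ∷ 1F ∷ 2F ∷ 3F ∷ 4F ∷ 5F ∷ 6F ∷ 8F ∷ [])) $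
      sparse 0F 3F 6F 8F) $
    split 0F 7F (
      split 1F 8F (detour (0F ∷ 7F ∷ 6F ∷ 5F ∷ 4F ∷ 3F ∷ 2F ∷ 1F ∷ 8F ∷ [])) $
      split⁻ 3F 8F (sparse 1F 3F 7F 8F) $
      split 1F 4F (detour (0F ∷ 7F ∷ 6F ∷ 5F ∷ 4F ∷ 1F ∷ 2F ∷ 3F ∷ 8F ∷ [])) $
      split⁻ 4F 7F (sparse 1F 3F 4F 7F) $
      split 1F 6F (detour (0F ∷ 7F ∷ 4F ∷ 5F ∷ 6F ∷ 1F ∷ 2F ∷ 3F ∷ 8F ∷ [])) $
      split 3F 6F (detour (0F ∷ 1F ∷ 2F ∷ 3F ∷ 6F ∷ 5F ∷ 4F ∷ 7F ∷ 8F ∷ [])) $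
      sparse 1F 3F 4F 6F) $
    -- With 0 7, 1 3, 1 7 and 3 7 absent, the vertices 0, 1, 3, 7 span only the path edge 0 1 and
    -- possibly 0 3, so 0 3 is forced.
    split⁻ 0F 3F (sparse 0F 1F 3F 7F) $
    split 1F 4F (detour (0F ∷ 3F ∷ 2F ∷ 1F ∷ 4F ∷ 5F ∷ 6F ∷ 7F ∷ 8F ∷ [])) $
    split⁻ 4F 7F (sparse 1F 3F 4F 7F) $
    split 1F 6F (detour (0F ∷ 3F ∷ 2F ∷ 1F ∷ 6F ∷ 5F ∷ 4F ∷ 7F ∷ 8F ∷ [])) $
    split 3F 6F (detour (0F ∷ 1F ∷ 2F ∷ 3F ∷ 6F ∷ 5F ∷ 4F ∷ 7F ∷ 8F ∷ [])) $
    sparse 1F 3F 4F 6F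

-- Order eight versus larger orders

theorem12 : (n : ℕ) (G : Graph n) → TwoConnected G → Is42Graph G → 8 ≤ n →
    ¬ UniquelyHamiltonian G
theorem12 n G _ is42 8≤n with m≤n⇒∃[o]m+o≡n 8≤n
... | zero  , refl = tree⇒¬unique 8 0 true (λ _ → refl) (ℕ.m≤m+n 4 4) cycle₈ G is42
-- `8 + suc m` and `9 + m` agree by computation, so a window of nine vertices leaves `m` outside,
-- possibly none.
... | suc m , refl = tree⇒¬unique 9 m false (λ ()) (ℕ.m≤m+n 4 5) path₉ G is42
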